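{- Let $S=\{s_0,\dots,s_{n-1}\}$ be an input set of $n$ strings, no one of which is a substring of another, let $K$ be a nonnegative integer, and let $c$ be the length of the longest string in $S$. The full SCSK algorithm, which runs in succession MISTAKES_FOR_PAIRS, SCSK_FOR_TRIPLES, SCS_FIRST_LAST and finally the main loop (all four procedures are specified in the context), has time complexity $$O\left(n^3c^2\log c+n^32^n\right).$$
   Context: Problem ($SCS_K$). Given a set $S=\{s_0,\dots,s_{n-1}\}$ of $n$ nonempty strings, none a substring of another in $S$, and an integer $K\ge 0$, find the shortest string $L$ such that all but one string of $S$ are exact substrings of $L$ and the remaining string fits into $L$ (occupies a block of consecutive positions of $L$) with at most $K$ mistakes, a mistake being a position where the two strings differ. The algorithm below is proposed for this problem and returns a length; the claim concerns only its running time. Notation. All indexing is 0-based; $a_i$ is the character of $a$ at position $i$; $|a|$ is the length of a string or list $a$; $\oplus$ is bitwise XOR and $\&$ bitwise AND on integers. $\{a,\dots,b\}$ is empty if $a>b$. $\mathrm{BINARYSEARCH}(a,x)$ returns the first index in the sorted list $a$ whose entry is greater than $x$, or $|a|$ if there is none. Cost model. Each of the following costs $O(1)$: integer arithmetic, comparison, MIN, MAX, array access, reading a character, appending to a list, reading the length of a list, bitwise operations on integers below $2^n$, and computing a power $2^x$ with $x\le n$. $\mathrm{BINARYSEARCH}(a,x)$ costs $O(1+\log(1+|a|))$. $O(f(n,c))$ means: at most a constant times $f(n,c)$ for all inputs with $n\ge 1$ and $c\ge 2$. (1) MISTAKES_FOR_PAIRS. All lists $\mathrm{MISTAKES}_{i,j,k}$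 start empty. For $i\in\{0,\dots,n-1\}$, for $j\in\{0,\dots,n-1\}$ with $j\neq i$, for $k\in\{0,\dots,|s_i|+|s_j|-1\}$, for $t\in\{0,\dots,|s_j|-1\}$: set $x\leftarrow k-|s_j|+1+t$; if $0\le x<|s_i|$ and $(s_j)_t\neq (s_i)_x$, append $x$ to $\mathrm{MISTAKES}_{i,j,k}$. (So $\mathrm{MISTAKES}_{i,j,k}$ is the increasing list of positions of $s_i$ at which $s_i$ and $s_j$ mismatch when the last character of $s_j$ is aligned with position $k$ of $s_i$.) (2) SCSK_FOR_TRIPLES. All entries $\mathrm{LMR}_{l,m,r}$ start at $+\infty$. For $l$, for $r$, for $m$ in $\{0,\dots,n-1\}$: if $l,m,r$ are not pairwise distinct, continue. Put $L=s_l$, $M=s_m$, $R=s_r$. For $len\in\{\max(|L|,|R|),\dots,|L|+|R|+|M|\}$: if $len<|L|+|R|$ and $|\mathrm{MISTAKES}_{l,r,2|L|+|R|-len-1}|\neq 0$, continue. Otherwise, for $start\in\{0,\dots,len-|M|\}$: set $MS\leftarrow 0$, $E\leftarrow start+|M|-1$ and $E'\leftarrow E-(len-|R|)$, and then - if $E<|L|$: $MS\leftarrow|\mathrm{MISTAKES}_{l,m,E}|$; - else if $start\ge len-|R|$: $MS\leftarrow|\mathrm{MISTAKES}_{r,m,E'}|$; - else if $len\ge|L|+|R|$: if $start<|L|$ add $|\mathrm{MISTAKES}_{l,m,E}|$ to $MS$; then if $E'\ge 0$ add $|\mathrm{MISTAKES}_{r,m,E'}|$ to $MS$; - else: $MS\leftarrow|\mathrm{MISTAKES}_{l,m,E}|+|\mathrm{MISTAKES}_{r,m,E'}|-\mathrm{BINARYSEARCH}(\mathrm{MISTAKES}_{r,m,E'},\,|L|+|R|-len-1)$.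 After this, if $MS\le K$, set $\mathrm{LMR}_{l,m,r}\leftarrow\mathrm{MIN}(len,\mathrm{LMR}_{l,m,r})$. (3) SCS_FIRST_LAST, consisting of three steps run in order. - COUNT_OVERLAPS: all entries start at $0$. For $w,v\in\{0,\dots,n-1\}$: if $v=w$ set $\mathrm{OVERLAP}_{w,v}\leftarrow|s_v|$; otherwise for $o\in\{1,\dots,|s_w|\}$, if $|\mathrm{MISTAKES}_{v,w,o}|=0$ set $\mathrm{OVERLAP}_{w,v}\leftarrow o$. - FILL_DP_RIGHT: $\mathrm{DP\_RIGHT}_{2^j,j}=|s_j|$ for each $j$, all other entries start at $+\infty$. For $mask\in\{1,\dots,2^n-1\}$ in increasing order, for $right\in\{0,\dots,n-1\}$ with $2^{right}\,\&\,mask\neq 0$, for $p\in\{0,\dots,n-1\}$ with $2^{p}\,\&\,mask\neq0$ and $p\neq right$: set $\mathrm{DP\_RIGHT}_{mask,right}$ to the minimum of its current value and $\mathrm{DP\_RIGHT}_{mask\oplus 2^{right},p}+|s_{right}|-\mathrm{OVERLAP}_{p,right}$. - FILL_DP_LEFT: the same with "leftmost" in place of "rightmost": $\mathrm{DP\_LEFT}_{2^j,j}=|s_j|$, all other entries start at $+\infty$, and $\mathrm{DP\_LEFT}_{mask,left}$ is updated to the minimum of its current value and $\mathrm{DP\_LEFT}_{mask\oplus 2^{left},p}+|s_{left}|-\mathrm{OVERLAP}_{left,p}$, over $left$ and $p\neq left$ in $mask$. (4) Main loop. $ANS\leftarrow$ NULL. For $l$, for $m$, for $r$ in $\{0,\dots,n-1\}$: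 if $l,m,r$ are not pairwise distinct, continue. For $leftMask\in\{0,\dots,2^n-1\}$: put $rightMask\leftarrow(2^n-1)\oplus leftMask$; if $leftMask\,\&\,2^l=0$ or $rightMask\,\&\,2^r=0$, continue; put $length\leftarrow \mathrm{LMR}_{l,m,r}-|s_l|-|s_r|+\mathrm{DP\_RIGHT}_{leftMask,l}+\mathrm{DP\_LEFT}_{rightMask,r}$; if $ANS$ is NULL or $length<ANS$, set $ANS\leftarrow length$. Return $ANS$. -}

module Defs where

open import Data.Bool.Base using (Bool; true; false; not; if_then_else_; _∧_; _xor_)
open import Data.Fin.Base using (Fin; toℕ)
import Data.Fin.Properties as Fin
open import Data.Integer.Base as ℤ using (ℤ; +_; -[1+_]; 0ℤ; 1ℤ)
import Data.Integer.Properties as ℤ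
open import Data.List.Base
  using (List; []; _∷_; _∷ʳ_; allFin; drop; head; length; map; tabulate; takeWhile; upTo)
open import Data.List.Extrema.Nat using (max)
open import Data.List.Relation.Binary.Infix.Heterogeneous using (Infix)
open import Data.Maybe.Base using (Maybe; just; nothing)
import Data.Maybe.Properties as Maybe
open import Data.Nat.Base
  using (ℕ; zero; suc; _+_; _*_; _∸_; _^_; _/_; _%_; _≤_; _⊔_; _≡ᵇ_)
open import Data.Nat.Logarithm using (⌊log₂_⌋)
import Data.Nat.Properties as ℕ
open import Data.Product.Base using (Σ-syntax; _×_; _,_)
import Data.Product.Properties as Product
open import Data.Unit.Base using (⊤; tt)
open import Function.Base using (_∘_)
open import Relation.Binary.Construct.Add.Supremum.Strict ℤ._<_ using (<⁺-dec)
open import Relation.Binary.Definitions using (DecidableEquality)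
open import Relation.Binary.PropositionalEquality.Core using (_≡_; _≢_)
open import Relation.Nullary.Construct.Add.Supremum using (_⁺; [_]; ⊤⁺)
open import Relation.Nullary.Decidable.Core using (does)
open import Relation.Nullary.Negation.Core using (¬_)

-- Basic operations of the machine; `binarySearch m` searches a list of length m.
data Op : Set where
  arith compare minMax access readChar append readLength bitwise power : Op
  binarySearch : ℕ → Op

nominal : Op → ℕ
nominal (binarySearch m) = 1 + ⌊log₂ 1 + m ⌋
nominal _                = 1

-- Each constant-time operation costs O(1), a binary search O(1 + log (1 + m)).
IsCostModel : (Op → ℕ) → Set
IsCostModel cost = Σ[ κ ∈ ℕ ] (∀ o → cost o ≤ κ * nominal o)

-- Integers with +∞.
ℤ∞ : Set
ℤ∞ = ℤ ⁺

infixl 6 _+∞_ _-∞_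

_+∞_ : ℤ∞ → ℤ∞ → ℤ∞
[ x ] +∞ [ y ] = [ x ℤ.+ y ]
_     +∞ _     = ⊤⁺

_-∞_ : ℤ∞ → ℤ → ℤ∞
[ x ] -∞ y = [ x ℤ.- y ]
⊤⁺    -∞ y = ⊤⁺

_<∞ᵇ_ : ℤ∞ → ℤ∞ → Bool
x <∞ᵇ y = does (<⁺-dec ℤ._<?_ x y)

_⊓∞_ : ℤ∞ → ℤ∞ → ℤ∞
x ⊓∞ y = if x <∞ᵇ y then x else y

-- a ⊔ b binary digits suffice, since a < 2 ^ a.
zipBits : (Bool → Bool → Bool) → ℕ → ℕ → ℕ
zipBits f a b = go (a ⊔ b) a b
  where
  go : ℕ → ℕ → ℕ → ℕ
  go zero    a b = 0
  go (suc d) a b =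
    (if f (a % 2 ≡ᵇ 1) (b % 2 ≡ᵇ 1) then 1 else 0) + 2 * go d (a / 2) (b / 2)

_xorᵇ_ _andᵇ_ : ℕ → ℕ → ℕ
_xorᵇ_ = zipBits _xor_
_andᵇ_ = zipBits _∧_

-- Both ranges include their endpoints and are empty when a > b.
[_⋯_] : ℤ → ℤ → List ℤ
[ a ⋯ b ] = map (λ i → a ℤ.+ + i) (upTo ℤ.∣ (b ℤ.- a ℤ.+ 1ℤ) ℤ.⊔ 0ℤ ∣)

[_⋯_]ℕ : ℕ → ℕ → List ℕ
[ a ⋯ b ]ℕ = map (λ i → a + i) (upTo (suc b ∸ a))

charAt : ∀ {A : Set} → List A → ℤ → Maybe A
charAt a (+ i)    = head (drop i a)
charAt a -[1+ _ ] = nothing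

-- For a sorted list, the first index whose entry exceeds x (or the length).
searchIndex : List ℤ → ℤ → ℤ
searchIndex a x = + length (takeWhile (ℤ._≤? x) a)

update : ∀ {X Y : Set} → DecidableEquality X → X → Y → (X → Y) → X → Y
update _≟_ x y f x′ = if does (x′ ≟ x) then y else f x′

-- The machine is a state monad over the arrays that also adds up the cost of
-- every operation executed.  Lifted operators take computations as operands
-- and charge for themselves; scalar local variables (bound with ←) are free.
module SCSK (cost : Op → ℕ) {A : Set} (_≟_ : DecidableEquality A)
            {n : ℕ} (s : Fin n → List A) (K : ℕ) where

  Idx : Set
  Idx = Fin n

  -- Cells outside the index range of an array are never used by the algorithm.
  record Memory : Set where
    field
      mistakes : Idx × Idx × ℤ → List ℤ
      lmr      : Idx × Idx × Idx → ℤ∞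
      overlaps : Idx × Idx → ℤ
      dpRight  : ℕ × Idx → ℤ∞
      dpLeft   : ℕ × Idx → ℤ∞
      ans      : Maybe ℤ∞
  open Memory

  initial : Memory
  initial = record
    { mistakes = λ _ → []
    ; lmr      = λ _ → ⊤⁺
    ; overlaps = λ _ → 0ℤ
    ; dpRight  = λ _ → ⊤⁺
    ; dpLeft   = λ _ → ⊤⁺
    ; ans      = nothing
    }

  Comp : Set → Set
  Comp X = Memory → X × Memory × ℕ

  infix  9 #_
  infixl 1 _>>=_ _>>_
  infix  0 ifᶜ_then_else_

  #_ : ∀ {X : Set} → X → Comp X
  (# x) σ = x , σ , 0

  _>>=_ : ∀ {X Y : Set} → Comp X → (X → Comp Y) → Comp Y
  (p >>= f) σ =
    let x , σ₁ , t₁ = p σ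
        y , σ₂ , t₂ = f x σ₁
    in  y , σ₂ , t₁ + t₂

  _>>_ : ∀ {X Y : Set} → Comp X → Comp Y → Comp Y
  p >> q = p >>= λ _ → q

  skip : Comp ⊤
  skip = # tt

  charge : Op → Comp ⊤
  charge o σ = tt , σ , cost o

  ifᶜ_then_else_ : ∀ {X : Set} → Comp Bool → Comp X → Comp X → Comp X
  ifᶜ p then q else r = do
    b ← p
    if b then q else r

  when unless : Comp Bool → Comp ⊤ → Comp ⊤
  when   p q = ifᶜ p then q else skip
  unless p q = ifᶜ p then skip else q

  infixr 3 _and_
  infixr 2 _or_

  -- Short-circuiting.
  _and_ _or_ : Comp Bool → Comp Bool → Comp Bool
  p and q = ifᶜ p then q else # false
  p or  q = ifᶜ p then # true else q

  -- Every iteration pays for a loop test and an increment; leaving the loop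
  -- pays for one more test.
  forEach : ∀ {X : Set} → List X → (X → Comp ⊤) → Comp ⊤
  forEach []       f = charge compare
  forEach (x ∷ xs) f = do
    charge compare
    f x
    charge arith
    forEach xs f

  op₁ : ∀ {X Y : Set} → Op → (X → Y) → Comp X → Comp Y
  op₁ o f p = do
    x ← p
    charge o
    # f x

  op₂ : ∀ {X Y Z : Set} → Op → (X → Y → Z) → Comp X → Comp Y → Comp Z
  op₂ o f p q = do
    x ← p
    y ← q
    charge o
    # f x y

  infixl 7 _⊠_
  infixl 6 _⊞_ _⊟_ _⊞∞_ _⊟∞_ _∸ℕ_ _⊕_
  infixl 5 _&_
  infix  4 _<ᶜ_ _≤ᶜ_ _≥ᶜ_ _≡ᶜ_ _≢ᶜ_ _≢ℕ_ _≢ˢ_ _≡ˢ_ _≢ᴬ_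

  _⊞_ _⊟_ _⊠_ : Comp ℤ → Comp ℤ → Comp ℤ
  _⊞_ = op₂ arith ℤ._+_
  _⊟_ = op₂ arith ℤ._-_
  _⊠_ = op₂ arith ℤ._*_

  finite : Comp ℤ → Comp ℤ∞
  finite p = do
    x ← p
    # [ x ]

  _⊞∞_ : Comp ℤ∞ → Comp ℤ∞ → Comp ℤ∞
  _⊞∞_ = op₂ arith _+∞_

  _⊟∞_ : Comp ℤ∞ → Comp ℤ → Comp ℤ∞
  _⊟∞_ = op₂ arith _-∞_

  _∸ℕ_ : Comp ℕ → Comp ℕ → Comp ℕ
  _∸ℕ_ = op₂ arith _∸_

  MAX : Comp ℤ → Comp ℤ → Comp ℤ
  MAX = op₂ minMax ℤ._⊔_

  MIN : Comp ℤ∞ → Comp ℤ∞ → Comp ℤ∞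
  MIN = op₂ minMax _⊓∞_

  _<ᶜ_ _≤ᶜ_ _≥ᶜ_ _≡ᶜ_ _≢ᶜ_ : Comp ℤ → Comp ℤ → Comp Bool
  _<ᶜ_ = op₂ compare λ x y → does (x ℤ.<? y)
  _≤ᶜ_ = op₂ compare λ x y → does (x ℤ.≤? y)
  _≥ᶜ_ = op₂ compare λ x y → does (y ℤ.≤? x)
  _≡ᶜ_ = op₂ compare λ x y → does (x ℤ.≟ y)
  _≢ᶜ_ = op₂ compare λ x y → not (does (x ℤ.≟ y))

  _≢ℕ_ : Comp ℕ → Comp ℕ → Comp Bool
  _≢ℕ_ = op₂ compare λ x y → not (does (x ℕ.≟ y))

  _≡ˢ_ _≢ˢ_ : Idx → Idx → Comp Bool
  i ≡ˢ j = op₂ compare (λ x y → does (x Fin.≟ y)) (# i) (# j)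
  i ≢ˢ j = op₂ compare (λ x y → not (does (x Fin.≟ y))) (# i) (# j)

  _≢ᴬ_ : Comp (Maybe A) → Comp (Maybe A) → Comp Bool
  _≢ᴬ_ = op₂ compare λ x y → not (does (Maybe.≡-dec _≟_ x y))

  pairwiseDistinct : Idx → Idx → Idx → Comp Bool
  pairwiseDistinct l m r = (l ≢ˢ m) and (m ≢ˢ r) and (l ≢ˢ r)

  2^_ : ℕ → Comp ℕ
  2^ x = op₁ power (λ y → 2 ^ y) (# x)

  _⊕_ _&_ : Comp ℕ → Comp ℕ → Comp ℕ
  _⊕_ = op₂ bitwise _xorᵇ_
  _&_ = op₂ bitwise _andᵇ_

  full : Comp ℕ
  full = 2^ n ∸ℕ # 1

  bitSet : Idx → ℕ → Comp Bool
  bitSet i mask = 2^ toℕ i & # mask ≢ℕ # 0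

  len : Idx → Comp ℤ
  len i = op₁ readLength (λ a → + length a) (# s i)

  char : Idx → ℤ → Comp (Maybe A)
  char i x = op₁ readChar (charAt (s i)) (# x)

  size : Comp (List ℤ) → Comp ℤ
  size = op₁ readLength (λ a → + length a)

  BINARYSEARCH : Comp (List ℤ) → Comp ℤ → Comp ℤ
  BINARYSEARCH p q = do
    a ← p
    x ← q
    charge (binarySearch (length a))
    # searchIndex a x

  read : ∀ {X : Set} → (Memory → X) → Comp X
  read f σ = f σ , σ , cost access

  write : (Memory → Memory) → Comp ⊤
  write f σ = tt , f σ , cost access

  MISTAKES : Idx → Idx → Comp ℤ → Comp (List ℤ)
  MISTAKES i j p = do
    k ← p
    read λ σ → mistakes σ (i , j , k)

  LMR : Idx → Idx → Idx → Comp ℤ∞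
  LMR l m r = read λ σ → lmr σ (l , m , r)

  OVERLAP : Idx → Idx → Comp ℤ
  OVERLAP w v = read λ σ → overlaps σ (w , v)

  DP_RIGHT DP_LEFT : Comp ℕ → Idx → Comp ℤ∞
  DP_RIGHT p i = do
    mask ← p
    read λ σ → dpRight σ (mask , i)
  DP_LEFT p i = do
    mask ← p
    read λ σ → dpLeft σ (mask , i)

  ANS : Comp (Maybe ℤ∞)
  ANS = read ans

  setMISTAKES : Idx → Idx → ℤ → List ℤ → Comp ⊤
  setMISTAKES i j k a = write λ σ → record σ { mistakes = update _≟ₖ_ (i , j , k) a (mistakes σ) }
    where _≟ₖ_ = Product.≡-dec Fin._≟_ (Product.≡-dec Fin._≟_ ℤ._≟_)

  setLMR : Idx → Idx → Idx → ℤ∞ → Comp ⊤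
  setLMR l m r x = write λ σ → record σ { lmr = update _≟ₖ_ (l , m , r) x (lmr σ) }
    where _≟ₖ_ = Product.≡-dec Fin._≟_ (Product.≡-dec Fin._≟_ Fin._≟_)

  setOVERLAP : Idx → Idx → ℤ → Comp ⊤
  setOVERLAP w v x = write λ σ → record σ { overlaps = update _≟ₖ_ (w , v) x (overlaps σ) }
    where _≟ₖ_ = Product.≡-dec Fin._≟_ Fin._≟_

  setDP_RIGHT setDP_LEFT : ℕ → Idx → ℤ∞ → Comp ⊤
  setDP_RIGHT mask i x = write λ σ → record σ { dpRight = update _≟ₖ_ (mask , i) x (dpRight σ) }
    where _≟ₖ_ = Product.≡-dec ℕ._≟_ Fin._≟_
  setDP_LEFT mask i x = write λ σ → record σ { dpLeft = update _≟ₖ_ (mask , i) x (dpLeft σ) }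
    where _≟ₖ_ = Product.≡-dec ℕ._≟_ Fin._≟_

  setANS : Maybe ℤ∞ → Comp ⊤
  setANS x = write λ σ → record σ { ans = x }

  appendMISTAKES : Idx → Idx → ℤ → ℤ → Comp ⊤
  appendMISTAKES i j k x = do
    a ← MISTAKES i j (# k)
    charge append
    setMISTAKES i j k (a ∷ʳ x)

  strings : List Idx
  strings = allFin n

  -- `initial` already holds the starting values; the init… loops write them
  -- explicitly so that the initialisation of the arrays is paid for.

  initMISTAKES : Comp ⊤
  initMISTAKES =
    forEach strings λ i →
    forEach strings λ j →
    when (j ≢ˢ i) do
      hi ← len i ⊞ len j ⊟ # 1ℤ
      forEach [ 0ℤ ⋯ hi ] λ k → setMISTAKES i j k []

  MISTAKES_FOR_PAIRS : Comp ⊤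
  MISTAKES_FOR_PAIRS = do
    initMISTAKES
    forEach strings λ i →
      forEach strings λ j →
      when (j ≢ˢ i) do
        kmax ← len i ⊞ len j ⊟ # 1ℤ
        forEach [ 0ℤ ⋯ kmax ] λ k → do
          tmax ← len j ⊟ # 1ℤ
          forEach [ 0ℤ ⋯ tmax ] λ t → do
            x ← # k ⊟ len j ⊞ # 1ℤ ⊞ # t
            when (# 0ℤ ≤ᶜ # x and # x <ᶜ len i and char j t ≢ᴬ char i x)
              (appendMISTAKES i j k x)

  initLMR : Comp ⊤
  initLMR =
    forEach strings λ l →
    forEach strings λ m →
    forEach strings λ r →
    setLMR l m r ⊤⁺

  -- The value of MS for the middle string placed at `start` in a string of
  -- length `ℓ`, with L = |s_l|, M = |s_m|, R = |s_r|.
  countMistakes : (l m r : Idx) (L M R ℓ start : ℤ) → Comp ℤ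
  countMistakes l m r L M R ℓ start = do
    E  ← # start ⊞ # M ⊟ # 1ℤ
    E′ ← # E ⊟ (# ℓ ⊟ # R)
    ifᶜ # E <ᶜ # L then
      size (MISTAKES l m (# E))
     else ifᶜ # start ≥ᶜ # ℓ ⊟ # R then
      size (MISTAKES r m (# E′))
     else ifᶜ # ℓ ≥ᶜ # L ⊞ # R then (do
      MS ← ifᶜ # start <ᶜ # L then # 0ℤ ⊞ size (MISTAKES l m (# E)) else # 0ℤ
      ifᶜ # E′ ≥ᶜ # 0ℤ then # MS ⊞ size (MISTAKES r m (# E′)) else # MS)
     else
      size (MISTAKES l m (# E)) ⊞ size (MISTAKES r m (# E′))
        ⊟ BINARYSEARCH (MISTAKES r m (# E′)) (# L ⊞ # R ⊟ # ℓ ⊟ # 1ℤ)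

  SCSK_FOR_TRIPLES : Comp ⊤
  SCSK_FOR_TRIPLES = do
    initLMR
    forEach strings λ l →
      forEach strings λ r →
      forEach strings λ m →
      when (pairwiseDistinct l m r) do
        L ← len l
        M ← len m
        R ← len r
        lo ← MAX (# L) (# R)
        hi ← # L ⊞ # R ⊞ # M
        forEach [ lo ⋯ hi ] λ ℓ →
          unless (# ℓ <ᶜ # L ⊞ # R and
                  size (MISTAKES l r (# (+ 2) ⊠ # L ⊞ # R ⊟ # ℓ ⊟ # 1ℤ)) ≢ᶜ # 0ℤ) do
            smax ← # ℓ ⊟ # M
            forEach [ 0ℤ ⋯ smax ] λ start → do
              MS ← countMistakes l m r L M R ℓ start
              when (# MS ≤ᶜ # (+ K)) do
                best ← MIN (# [ ℓ ]) (LMR l m r)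
                setLMR l m r best

  initOVERLAP : Comp ⊤
  initOVERLAP =
    forEach strings λ w →
    forEach strings λ v →
    setOVERLAP w v 0ℤ

  COUNT_OVERLAPS : Comp ⊤
  COUNT_OVERLAPS = do
    initOVERLAP
    forEach strings λ w →
      forEach strings λ v →
      ifᶜ v ≡ˢ w then (do
        x ← len v
        setOVERLAP w v x)
       else (do
        omax ← len w
        forEach [ 1ℤ ⋯ omax ] λ o →
          when (size (MISTAKES v w (# o)) ≡ᶜ # 0ℤ) (setOVERLAP w v o))

  initDP : (ℕ → Idx → ℤ∞ → Comp ⊤) → Comp ⊤
  initDP set = do
    top ← full
    forEach [ 0 ⋯ top ]ℕ λ mask →
      forEach strings λ j →
      set mask j ⊤⁺
    forEach strings λ j → do
      mask ← 2^ toℕ j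
      x    ← len j
      set mask j [ x ]

  FILL_DP_RIGHT : Comp ⊤
  FILL_DP_RIGHT = do
    initDP setDP_RIGHT
    top ← full
    forEach [ 1 ⋯ top ]ℕ λ mask →
      forEach strings λ right →
      when (bitSet right mask) (
      forEach strings λ p →
      when (bitSet p mask and (p ≢ˢ right)) do
        x ← MIN (DP_RIGHT (# mask) right)
                (DP_RIGHT (# mask ⊕ 2^ toℕ right) p ⊞∞ finite (len right) ⊟∞ OVERLAP p right)
        setDP_RIGHT mask right x)

  FILL_DP_LEFT : Comp ⊤
  FILL_DP_LEFT = do
    initDP setDP_LEFT
    top ← full
    forEach [ 1 ⋯ top ]ℕ λ mask →
      forEach strings λ left →
      when (bitSet left mask) (
      forEach strings λ p →
      when (bitSet p mask and (p ≢ˢ left)) do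
        x ← MIN (DP_LEFT (# mask) left)
                (DP_LEFT (# mask ⊕ 2^ toℕ left) p ⊞∞ finite (len left) ⊟∞ OVERLAP left p)
        setDP_LEFT mask left x)

  SCS_FIRST_LAST : Comp ⊤
  SCS_FIRST_LAST = do
    COUNT_OVERLAPS
    FILL_DP_RIGHT
    FILL_DP_LEFT

  isNull : Maybe ℤ∞ → Bool
  isNull nothing  = true
  isNull (just _) = false

  _<ANS : ℤ∞ → Comp Bool
  x <ANS = op₁ compare (λ { nothing → false ; (just y) → x <∞ᵇ y }) ANS

  MAIN_LOOP : Comp (Maybe ℤ∞)
  MAIN_LOOP = do
    setANS nothing
    forEach strings λ l →
      forEach strings λ m →
      forEach strings λ r →
      when (pairwiseDistinct l m r) do
        top ← full
        forEach [ 0 ⋯ top ]ℕ λ leftMask → do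
          rightMask ← full ⊕ # leftMask
          when (bitSet l leftMask and bitSet r rightMask) do
            x ← LMR l m r ⊟∞ len l ⊟∞ len r
                  ⊞∞ DP_RIGHT (# leftMask) l ⊞∞ DP_LEFT (# rightMask) r
            when (op₁ compare isNull ANS or x <ANS) (setANS (just x))
    ANS

  algorithm : Comp (Maybe ℤ∞)
  algorithm = do
    MISTAKES_FOR_PAIRS
    SCSK_FOR_TRIPLES
    SCS_FIRST_LAST
    MAIN_LOOP

  result : Maybe ℤ∞
  result = let x , _ , _ = algorithm initial in x

  time : ℕ
  time = let _ , _ , t = algorithm initial in t

module _ {A : Set} {n : ℕ} (s : Fin n → List A) where

  longest : ℕ
  longest = max 0 (tabulate (length ∘ s))

  Nonempty : Set
  Nonempty = ∀ i → s i ≢ []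

  SubstringFree : Set
  SubstringFree = ∀ i j → i ≢ j → ¬ Infix _≡_ (s i) (s j)

{-# OPTIONS --safe #-}
module Submission where

open import Defs
open import Data.Bool.Base using (Bool; not; true; false; if_then_else_; T)
open import Data.Fin.Base using (Fin; toℕ)
import Data.Fin.Properties as Fin
open import Data.Integer.Base as ℤ using (ℤ; +_; 0ℤ; 1ℤ; +≤+)
import Data.Integer.Properties as ℤ
import Data.Integer.Tactic.RingSolver as ℤ-Solver
open import Data.List.Base using (List; []; _∷_; _∷ʳ_; length; map; tabulate; upTo)
open import Data.List.Extrema.Nat using (xs≤max)
open import Data.List.Membership.Propositional using (_∈_)
open import Data.List.Membership.Propositional.Properties using (∈-map⁻; ∈-tabulate⁺; ∈-upTo⁻)
open import Data.List.Properties using (length-++; length-map; length-tabulate; length-upTo)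
open import Data.List.Relation.Unary.All using (lookup)
open import Data.List.Relation.Unary.Any using (here; there)
open import Data.Maybe.Base using (just; nothing)
import Data.Maybe.Properties as Maybe
open import Data.Nat.Base hiding (compare)
open import Data.Nat.Logarithm using (⌊log₂_⌋; ⌊log₂⌋-mono-≤; ⌊log₂[2^n]⌋≡n)
open import Data.Nat.Properties hiding (_≟_)
import Data.Nat.Properties as ℕ
open import Data.Nat.Tactic.RingSolver using (solve-∀)
open import Data.Product.Base using (Σ-syntax; _×_; _,_; proj₁; proj₂)
import Data.Product.Properties as Product
open import Data.Sum.Base using (inj₁; inj₂)
open import Data.Unit.Base using (⊤; tt)
open import Function.Base using (id; _∘_)
open import Relation.Binary.Definitions using (DecidableEquality)
open import Relation.Binary.PropositionalEquality
  using (_≡_; refl; sym; trans; cong; cong₂; subst)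
open import Relation.Nullary.Construct.Add.Supremum using ([_]; ⊤⁺)
open import Relation.Nullary.Decidable.Core using (does)

-- Every loop over positions has at most d = 4 c iterations, so each procedure other than the
-- binary search costs O(n³ c² + n³ 2ⁿ) by counting iterations.  A list in MISTAKES is no longer
-- than the total number n² d² of appends.  This crude bound is enough for the binary search:
-- log (n² d²) is O(log c) if n ≤ c, and if c ≤ n then c² log (n² d²) is O(n³), hence O(2ⁿ).

-- The lists in `MISTAKES` in fact have at most `c` elements, but showing this needs an invariant
-- that ties each cell to the one iteration that fills it. The crude bound needs only that an append
-- lengthens one list by one, so a single number, valid for all cells at once, is carried from step
-- to step. The price is a power of `n` inside the logarithm: c² log n is not O(c² log c), and for
-- large `n` it is the summand 2ⁿ of the claimed bound that takes it in. The other obstacle is that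
-- loop limits are values computed by the program, so bounding the number of iterations requires
-- following these values through the monad.

-- Powers of two against logarithms and cubes.

n<2^[1+log₂n] : ∀ n → n < 2 ^ (1 + ⌊log₂ n ⌋)
n<2^[1+log₂n] n = ≰⇒> λ 2^≤n →
  <-irrefl refl (subst (_≤ ⌊log₂ n ⌋) (⌊log₂[2^n]⌋≡n (1 + ⌊log₂ n ⌋)) (⌊log₂⌋-mono-≤ 2^≤n))

n<2^n : ∀ n → n < 2 ^ n
n<2^n zero    = s≤s z≤n
n<2^n (suc n) = begin
  2 + n           ≤⟨ +-mono-≤ (m^n>0 2 n) (n<2^n n) ⟩
  2 ^ n + 2 ^ n   ≡⟨ m+m≡2*m (2 ^ n) ⟩
  2 ^ suc n       ∎
  where
  open ≤-Reasoning
  m+m≡2*m : ∀ m → m + m ≡ 2 * m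
  m+m≡2*m = solve-∀

-- The lower-order terms make the left-hand side at most double from n to 1 + n.
n³≤13*2^n : ∀ n → n * n * n ≤ 13 * 2 ^ n
n³≤13*2^n n = ≤-trans (m≤m+n _ _) (bound n)
  where
  open ≤-Reasoning
  -- Comparing coefficients shows that this is the polynomial solution of q (1 + n) = 2 q n - n³.
  -- Its value 13 at 0 is the constant of the bound.
  q : ℕ → ℕ
  q n = n * n * n + (3 * n * n + 9 * n + 13)

  q-step : ∀ n → (1 + n) * (1 + n) * (1 + n) + (3 * (1 + n) * (1 + n) + 9 * (1 + n) + 13)
               + n * n * n
             ≡ 2 * (n * n * n + (3 * n * n + 9 * n + 13))
  q-step = solve-∀

  swap : ∀ a → 2 * (13 * a) ≡ 13 * (2 * a)
  swap = solve-∀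

  bound : ∀ n → q n ≤ 13 * 2 ^ n
  bound zero    = ≤-refl
  bound (suc n) = begin
    q (suc n)               ≤⟨ m≤m+n _ (n * n * n) ⟩
    q (suc n) + n * n * n   ≡⟨ q-step n ⟩
    2 * q n                 ≤⟨ *-monoʳ-≤ 2 (bound n) ⟩
    2 * (13 * 2 ^ n)        ≡⟨ swap (2 ^ n) ⟩
    13 * 2 ^ suc n          ∎

-- Arithmetic of the claimed bound.

searchCost : ℕ → ℕ
searchCost N = 1 + ⌊log₂ 1 + N ⌋

searchCost-mono : ∀ {M N} → M ≤ N → searchCost M ≤ searchCost N
searchCost-mono M≤N = s≤s (⌊log₂⌋-mono-≤ (s≤s M≤N))

-- `forEach-grow` multiplies the growth of a loop body by the number of iterations, from a single
-- append outwards. With this nesting, final `* 1` included, the growth over the loops of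
-- `MISTAKES_FOR_PAIRS` has this form by definition.
appends : ℕ → ℕ → ℕ
appends n d = n * (n * (d * (d * 1)))

appends-mono : ∀ {n n′ d d′} → n ≤ n′ → d ≤ d′ → appends n d ≤ appends n′ d′
appends-mono n≤ d≤ = *-mono-≤ n≤ (*-mono-≤ n≤ (*-mono-≤ d≤ (*-monoˡ-≤ 1 d≤)))

-- Replacing both `n` and `c` by the larger of them, `x`, leaves 16 x⁴, and 1 + 16 · 2^(4p) ≤ 17 ·
-- 2^(4p) ≤ 2^(5 + 4p). The exponent `p` will be 1 + ⌊log₂ c⌋ if n ≤ c, and `n` if c ≤ n.
searchCost-appends : ∀ {x} p → x ≤ 2 ^ p → searchCost (appends x (4 * x)) ≤ 6 + 4 * p
searchCost-appends {x} p x≤ = s≤s (begin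
  ⌊log₂ 1 + appends x (4 * x) ⌋  ≤⟨ ⌊log₂⌋-mono-≤ 1+appends≤ ⟩
  ⌊log₂ 2 ^ (5 + 4 * p) ⌋        ≡⟨ ⌊log₂[2^n]⌋≡n (5 + 4 * p) ⟩
  5 + 4 * p                      ∎)
  where
  open ≤-Reasoning
  expand : ∀ y → y * (y * (4 * y * (4 * y * 1))) ≡ 16 * (y * (y * (y * (y * 1))))
  expand = solve-∀

  2^4p : 2 ^ (4 * p) ≡ (2 ^ p) ^ 4
  2^4p = trans (cong (2 ^_) (*-comm 4 p)) (sym (^-*-assoc 2 p 4))

  1+appends≤ : 1 + appends x (4 * x) ≤ 2 ^ (5 + 4 * p)
  1+appends≤ = begin
    1 + appends x (4 * x)              ≤⟨ +-mono-≤ (m^n>0 2 (4 * p)) (appends-mono x≤ (*-monoʳ-≤ 4 x≤)) ⟩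
    2 ^ (4 * p) + appends (2 ^ p) (4 * 2 ^ p)
                                       ≡⟨ cong (λ z → 2 ^ (4 * p) + z) (expand (2 ^ p)) ⟩
    2 ^ (4 * p) + 16 * (2 ^ p) ^ 4     ≡⟨ cong (λ z → 2 ^ (4 * p) + 16 * z) 2^4p ⟨
    17 * 2 ^ (4 * p)                   ≤⟨ *-monoˡ-≤ (2 ^ (4 * p)) (m≤m+n 17 15) ⟩
    32 * 2 ^ (4 * p)                   ≡⟨ ^-distribˡ-+-* 2 5 (4 * p) ⟨
    2 ^ (5 + 4 * p)                    ∎

6+4p≤10p : ∀ {p} → 1 ≤ p → 6 + 4 * p ≤ 10 * p
6+4p≤10p {p} 1≤p = begin
  6 + 4 * p      ≤⟨ +-monoˡ-≤ (4 * p) (*-monoʳ-≤ 6 1≤p) ⟩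
  6 * p + 4 * p  ≡⟨ *-distribʳ-+ p 6 4 ⟨
  10 * p         ∎
  where open ≤-Reasoning

-- For n ≤ c the logarithm is O(log c); for c ≤ n the whole left-hand side is O(n³).
c²*searchCost≤ : ∀ {n c} → 1 ≤ n → 2 ≤ c →
  c * c * searchCost (appends n (4 * c)) ≤ 130 * (c * c * ⌊log₂ c ⌋ + 2 ^ n)
c²*searchCost≤ {n} {c} 1≤n 2≤c with ≤-total n c
... | inj₁ n≤c = begin
  c * c * searchCost (appends n (4 * c))    ≤⟨ *-monoʳ-≤ (c * c) search ⟩
  c * c * (20 * λc)                         ≡⟨ swap (c * c) λc ⟩
  20 * (c * c * λc)                         ≤⟨ *-mono-≤ (m≤m+n 20 110) (m≤m+n (c * c * λc) (2 ^ n)) ⟩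
  130 * (c * c * λc + 2 ^ n)                ∎
  where
  open ≤-Reasoning
  λc = ⌊log₂ c ⌋

  -- For `c = 1` the logarithm vanishes and could not absorb the additive constants below.
  1≤λc : 1 ≤ λc
  1≤λc = ⌊log₂⌋-mono-≤ 2≤c

  swap : ∀ a b → a * (20 * b) ≡ 20 * (a * b)
  swap = solve-∀

  double : ∀ a → 10 * (a + a) ≡ 20 * a
  double = solve-∀

  search : searchCost (appends n (4 * c)) ≤ 20 * λc
  search = begin
    searchCost (appends n (4 * c))  ≤⟨ searchCost-mono (appends-mono n≤c (≤-refl {4 * c})) ⟩
    searchCost (appends c (4 * c))  ≤⟨ searchCost-appends (1 + λc) (<⇒≤ (n<2^[1+log₂n] c)) ⟩
    6 + 4 * (1 + λc)                ≤⟨ 6+4p≤10p (s≤s z≤n) ⟩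
    10 * (1 + λc)                   ≤⟨ *-monoʳ-≤ 10 (+-monoˡ-≤ λc 1≤λc) ⟩
    10 * (λc + λc)                  ≡⟨ double λc ⟩
    20 * λc                         ∎
... | inj₂ c≤n = begin
  c * c * searchCost (appends n (4 * c))    ≤⟨ *-mono-≤ (*-mono-≤ c≤n c≤n) search ⟩
  n * n * (10 * n)                          ≡⟨ swap n ⟩
  10 * (n * n * n)                          ≤⟨ *-monoʳ-≤ 10 (n³≤13*2^n n) ⟩
  10 * (13 * 2 ^ n)                         ≡⟨ *-assoc 10 13 (2 ^ n) ⟨
  130 * 2 ^ n                               ≤⟨ *-monoʳ-≤ 130 (m≤n+m (2 ^ n) (c * c * ⌊log₂ c ⌋)) ⟩
  130 * (c * c * ⌊log₂ c ⌋ + 2 ^ n)         ∎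
  where
  open ≤-Reasoning
  swap : ∀ a → a * a * (10 * a) ≡ 10 * (a * a * a)
  swap = solve-∀

  search : searchCost (appends n (4 * c)) ≤ 10 * n
  search = begin
    searchCost (appends n (4 * c))  ≤⟨ searchCost-mono (appends-mono {n} ≤-refl (*-monoʳ-≤ 4 c≤n)) ⟩
    searchCost (appends n (4 * n))  ≤⟨ searchCost-appends n (<⇒≤ (n<2^n n)) ⟩
    6 + 4 * n                       ≤⟨ 6+4p≤10p 1≤n ⟩
    10 * n                          ∎

tripleCost : ℕ → ℕ → ℕ
tripleCost n d = n * (n * (n * (d * (d * searchCost (appends n d)))))

subsetCost : ℕ → ℕ
subsetCost n = n * (n * (n * 2 ^ n))

-- Since d² = 16 c², the estimate of c² times the search cost enters 16 times: 2081 = 16 * 130 + 1,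
-- the 1 being for `subsetCost`. The factor n³ turns the 2ⁿ of that estimate into the second summand
-- of the bound.
tripleCost+subsetCost≤ : ∀ {n c} → 1 ≤ n → 2 ≤ c →
  tripleCost n (4 * c) + subsetCost n
    ≤ 2081 * (n ^ 3 * c ^ 2 * ⌊log₂ c ⌋ + n ^ 3 * 2 ^ n)
tripleCost+subsetCost≤ {n} {c} 1≤n 2≤c = begin
  tripleCost n (4 * c) + subsetCost n
    ≡⟨ regroup n c (searchCost (appends n (4 * c))) (2 ^ n) ⟩
  n * n * n * (16 * (c * c * searchCost (appends n (4 * c))) + 2 ^ n)
    ≤⟨ *-monoʳ-≤ (n * n * n) (+-mono-≤ (*-monoʳ-≤ 16 (c²*searchCost≤ 1≤n 2≤c))
                                        (m≤n+m (2 ^ n) (c * c * ⌊log₂ c ⌋))) ⟩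
  n * n * n * (16 * (130 * (c * c * ⌊log₂ c ⌋ + 2 ^ n)) + (c * c * ⌊log₂ c ⌋ + 2 ^ n))
    ≡⟨ collect n c ⌊log₂ c ⌋ (2 ^ n) ⟩
  2081 * (n ^ 3 * c ^ 2 * ⌊log₂ c ⌋ + n ^ 3 * 2 ^ n) ∎
  where
  open ≤-Reasoning
  regroup : ∀ n c b e →
    n * (n * (n * (4 * c * (4 * c * b)))) + n * (n * (n * e))
      ≡ n * n * n * (16 * (c * c * b) + e)
  regroup = solve-∀

  collect : ∀ n c l e →
    n * n * n * (16 * (130 * (c * c * l + e)) + (c * c * l + e))
      ≡ 2081 * ((n * (n * (n * 1))) * (c * (c * 1)) * l + (n * (n * (n * 1))) * e)
  collect = solve-∀

-- Lengths of strings and of loop ranges.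

length≤longest : ∀ {A : Set} {n} (s : Fin n → List A) i → length (s i) ≤ longest s
length≤longest s i = lookup (xs≤max 0 (tabulate (length ∘ s))) (∈-tabulate⁺ i)

length-map-upTo : ∀ {B : Set} (f : ℕ → B) m → length (map f (upTo m)) ≡ m
length-map-upTo f m = trans (length-map f (upTo m)) (length-upTo m)

width≤ : ∀ {a b m} → 0ℤ ℤ.≤ a → b ℤ.≤ + m → (b ℤ.- a ℤ.+ 1ℤ) ℤ.⊔ 0ℤ ℤ.≤ + suc m
width≤ {a} {b} {m} 0≤a b≤m = ℤ.⊔-lub
  (subst (b ℤ.- a ℤ.+ 1ℤ ℤ.≤_) (ℤ.+-comm (+ m) 1ℤ)
    (ℤ.+-monoˡ-≤ 1ℤ (ℤ.≤-trans (ℤ.+-mono-≤ b≤m (ℤ.neg-mono-≤ 0≤a))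
                                (ℤ.≤-reflexive (ℤ.+-identityʳ (+ m))))))
  (+≤+ z≤n)

length-interval≤ : ∀ {a b m} → 0ℤ ℤ.≤ a → b ℤ.≤ + m → length [ a ⋯ b ] ≤ suc m
length-interval≤ {a} {b} {m} 0≤a b≤m = begin
  length [ a ⋯ b ]                  ≡⟨ length-map-upTo _ _ ⟩
  ℤ.∣ (b ℤ.- a ℤ.+ 1ℤ) ℤ.⊔ 0ℤ ∣     ≤⟨ ℤ.drop‿+≤+ (ℤ.≤-trans (ℤ.≤-reflexive (ℤ.0≤i⇒+∣i∣≡i (ℤ.i≤j⊔i _ 0ℤ))) (width≤ 0≤a b≤m)) ⟩
  suc m                             ∎
  where open ≤-Reasoning

-- The range of `start` depends on the variable `ℓ` of the enclosing loop, so its length can be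
-- bounded only if each iteration knows that `ℓ` is at most the upper limit.
∈-interval⇒≤ : ∀ {a b x} → x ∈ [ a ⋯ b ] → x ℤ.≤ b
∈-interval⇒≤ {a} {b} x∈ with ∈-map⁻ _ x∈
... | i , i∈ , refl = upper (∈-upTo⁻ i∈)
  where
  w : ℤ
  w = b ℤ.- a ℤ.+ 1ℤ

  shift : ∀ a i → a ℤ.+ i ≡ 1ℤ ℤ.+ i ℤ.+ (a ℤ.- 1ℤ)
  shift = ℤ-Solver.solve-∀

  unshift : ∀ a b → b ℤ.- a ℤ.+ 1ℤ ℤ.+ (a ℤ.- 1ℤ) ≡ b
  unshift = ℤ-Solver.solve-∀

  upper : i < ℤ.∣ w ℤ.⊔ 0ℤ ∣ → a ℤ.+ + i ℤ.≤ b
  upper i< with ℤ.⊔-sel w 0ℤ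
  ... | inj₂ ≡0 with () ← subst (λ z → i < ℤ.∣ z ∣) ≡0 i<
  ... | inj₁ ≡w = begin
    a ℤ.+ + i                      ≡⟨ shift a (+ i) ⟩
    + suc i ℤ.+ (a ℤ.- 1ℤ)         ≤⟨ ℤ.+-monoˡ-≤ (a ℤ.- 1ℤ) i<w ⟩
    w ℤ.+ (a ℤ.- 1ℤ)               ≡⟨ unshift a b ⟩
    b                              ∎
    where
    open ℤ.≤-Reasoning
    i<w : + suc i ℤ.≤ w
    i<w = begin
      + suc i                 ≤⟨ +≤+ i< ⟩
      + ℤ.∣ w ℤ.⊔ 0ℤ ∣        ≡⟨ ℤ.0≤i⇒+∣i∣≡i (ℤ.i≤j⊔i w 0ℤ) ⟩
      w ℤ.⊔ 0ℤ                ≡⟨ ≡w ⟩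
      w                       ∎

length-[⋯2^n∸1]≤ : ∀ a n → length [ a ⋯ 2 ^ n ∸ 1 ]ℕ ≤ 2 ^ n
length-[⋯2^n∸1]≤ a n = begin
  length [ a ⋯ 2 ^ n ∸ 1 ]ℕ  ≡⟨ length-map-upTo _ _ ⟩
  suc (2 ^ n ∸ 1) ∸ a        ≤⟨ m∸n≤m _ a ⟩
  suc (2 ^ n ∸ 1)            ≡⟨ suc-pred (2 ^ n) {{m^n≢0 2 n}} ⟩
  2 ^ n                      ∎
  where open ≤-Reasoning

-- Rules for bounding the time of a computation.

module CostLogic (cost : Op → ℕ) (κ : ℕ) (cost≤ : ∀ o → cost o ≤ κ * nominal o)
                 {A : Set} (_≟_ : DecidableEquality A) {n : ℕ} (s : Fin n → List A) (K : ℕ) where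

  open SCSK cost _≟_ s K
  open Memory

  instance
    -- Units are products of loop bounds and must be positive for one operation to fit into a unit.
    -- This lets instance search supply that condition.
    *-nonZero : ∀ {m n} → .{{_ : NonZero m}} → .{{_ : NonZero n}} → NonZero (m * n)
    *-nonZero {m} {n} = m*n≢0 m n

  Short : ℕ → Memory → Set
  Short N σ = ∀ key → length (mistakes σ key) ≤ N

  -- A Hoare triple on the lengths of the lists in MISTAKES, the only part of the state
  -- on which the cost of an operation depends.  Time is counted as k units of size U,
  -- with k always a numeral: a loop of at most m iterations turns U into m * U.
  record Run {X : Set} (N : ℕ) (p : Comp X) (M k U : ℕ) : Set where
    constructor run
    field
      step : ∀ σ → Short N σ →
             Short M (proj₁ (proj₂ (p σ))) × proj₂ (proj₂ (p σ)) ≤ κ * (k * U)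
  open Run

  -- `Run` forgets the value of a computation, but a loop limit must be known to bound the
  -- iterations. The limits are computed without changing the memory, and their values do not depend
  -- on it.
  record Returns {X : Set} (p : Comp X) (v : X) (k U : ℕ) : Set where
    constructor returns
    field
      value  : ∀ σ → proj₁ (p σ) ≡ v
      pure   : ∀ σ → proj₁ (proj₂ (p σ)) ≡ σ
      price≤ : ∀ σ → proj₂ (proj₂ (p σ)) ≤ κ * (k * U)

  private variable
    X Y Z : Set
    N M M′ k k′ k″ U V : ℕ

  +-price : ∀ {a b} k k′ → a ≤ κ * (k * U) → b ≤ κ * (k′ * U) → a + b ≤ κ * ((k + k′) * U)
  +-price {U} {a} {b} k k′ a≤ b≤ = begin
    a + b                          ≤⟨ +-mono-≤ a≤ b≤ ⟩
    κ * (k * U) + κ * (k′ * U)     ≡⟨ *-distribˡ-+ κ (k * U) (k′ * U) ⟨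
    κ * (k * U + k′ * U)           ≡⟨ cong (κ *_) (*-distribʳ-+ U k k′) ⟨
    κ * ((k + k′) * U)             ∎
    where open ≤-Reasoning

  op-price : ∀ o → nominal o ≤ U → cost o ≤ κ * (1 * U)
  op-price {U} o o≤ = ≤-trans (cost≤ o) (*-monoʳ-≤ κ (≤-trans o≤ (≤-reflexive (sym (*-identityˡ U)))))

  -- This evaluates to `⊤` for every constructor except `binarySearch`, so arguments of this type
  -- are filled in silently.
  Basic : Op → Set
  Basic o = T (nominal o ≡ᵇ 1)

  basic-price : ∀ o {_ : Basic o} → .{{NonZero U}} → cost o ≤ κ * (1 * U)
  basic-price {U} o {b} = op-price o (≤-trans (≤-reflexive (≡ᵇ⇒≡ (nominal o) 1 b)) (>-nonZero⁻¹ U))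

  weaken : {p : Comp X} → M ≤ M′ → k * U ≤ k′ * V → Run N p M k U → Run N p M′ k′ V
  weaken M≤ kU≤ r .step σ h with step r σ h
  ... | h′ , t≤ = (λ key → ≤-trans (h′ key) M≤) , ≤-trans t≤ (*-monoʳ-≤ κ kU≤)

  more : {p : Comp X} → k ≤ k′ → Run N p M k U → Run N p M k′ U
  more {U = U} k≤ = weaken ≤-refl (*-monoˡ-≤ U k≤)

  infixr 1 _then_ _thenₛ_ _binding_

  _then_ : {p : Comp X} {f : X → Comp Y} →
           Run N p M k U → (∀ x → Run M (f x) M′ k′ U) → Run N (p >>= f) M′ (k + k′) U
  _then_ {k = k} {k′ = k′} {p = p} r r′ .step σ h with step r σ h
  ... | h₁ , t₁ with step (r′ (proj₁ (p σ))) _ h₁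
  ... | h₂ , t₂ = h₂ , +-price k k′ t₁ t₂

  _thenₛ_ : {p : Comp X} {q : Comp Y} →
            Run N p M k U → Run M q M′ k′ U → Run N (p >> q) M′ (k + k′) U
  r thenₛ r′ = r then λ _ → r′

  #-run : (x : X) → Run N (# x) N 0 U
  #-run x .step σ h = h , z≤n

  charge-run : ∀ o {_ : Basic o} → .{{NonZero U}} → Run N (charge o) N 1 U
  charge-run o {b} .step σ h = h , basic-price o {b}

  read-run : (f : Memory → X) → .{{NonZero U}} → Run N (read f) N 1 U
  read-run f .step σ h = h , basic-price access

  write-run : (f : Memory → Memory) → .{{NonZero U}} →
              (∀ σ → Short N σ → Short M (f σ)) → Run N (write f) M 1 U
  write-run f f-short .step σ h = f-short σ h , basic-price access

  op₁-run : ∀ o (f : X → Y) {p} {_ : Basic o} → .{{NonZero U}} →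
            Run N p M k U → Run N (op₁ o f p) M (k + 1) U
  op₁-run {k = k} o f {p} {b} r .step σ h with step r σ h
  ... | h′ , t = h′ , +-price k 1 t (+-price 1 0 (basic-price o {b}) z≤n)

  op₂-run : ∀ o (f : X → Y → Z) {p q} {_ : Basic o} → .{{NonZero U}} →
            Run N p N k U → Run N q N k′ U → Run N (op₂ o f p q) N (k + (k′ + 1)) U
  op₂-run {k = k} {k′} o f {p} {q} {b} r r′ .step σ h with step r σ h
  ... | h₁ , t₁ with step r′ _ h₁
  ... | h₂ , t₂ = h₂ , +-price k (k′ + 1) t₁ (+-price k′ 1 t₂ (+-price 1 0 (basic-price o {b}) z≤n))

  -- Adding the prices of the two branches instead of taking their maximum costs only a constant
  -- factor.
  if-run : ∀ {p q : Comp X} → Run N p M k U → Run N q M k′ U →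
           ∀ b → Run N (if b then p else q) M (k + k′) U
  if-run {k = k} {k′ = k′} r r′ true  = more (m≤m+n k k′) r
  if-run {k = k} {k′ = k′} r r′ false = more (m≤n+m k′ k) r′

  ifᶜ-run : {c : Comp Bool} {p q : Comp X} →
            Run N c N k U → Run N p M k′ U → Run N q M k″ U →
            Run N (ifᶜ c then p else q) M (k + (k′ + k″)) U
  ifᶜ-run {p = p} {q = q} r r′ r″ = _then_ {f = λ b → if b then p else q} r (if-run r′ r″)

  when-run : {c : Comp Bool} {p : Comp ⊤} → N ≤ M →
             Run N c N k U → Run N p M k′ U → Run N (when c p) M (k + (k′ + 0)) U
  when-run N≤M r r′ = ifᶜ-run r r′ (weaken {k = 0} {U = 1} N≤M z≤n (#-run tt))

  unless-run : {c : Comp Bool} {p : Comp ⊤} →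
               Run N c N k U → Run N p N k′ U → Run N (unless c p) N (k + (0 + k′)) U
  unless-run r r′ = ifᶜ-run r (#-run tt) r′

  -- `I i` bounds the lists after `i` iterations, so one induction covers loops that leave the lists
  -- alone (`I` constant) and loops that lengthen them (`I` linear). Each iteration pays 2 beyond
  -- its body, and the `suc` is the test that leaves the loop.
  forEach-sum : (I : ℕ → ℕ) {xs : List X} {f : X → Comp ⊤} →
                (∀ i x → x ∈ xs → Run (I i) (f x) (I (suc i)) k U) → ∀ i →
                Run (I i) (forEach xs f) (I (length xs + i)) (suc (length xs * (2 + k * U))) 1
  forEach-sum I {[]} r i = charge-run compare
  forEach-sum {k = k} {U} I {x ∷ xs} {f} r i =
    weaken (≤-reflexive (cong I (+-suc (length xs) i)))
      (≤-reflexive (cong (_* 1) (count (k * U) (length xs * (2 + k * U)))))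
      (charge-run compare
        then λ _ → weaken {k = k} {U = U} {k′ = k * U} {V = 1} ≤-refl
                     (≤-reflexive (sym (*-identityʳ (k * U)))) (r i x (here refl))
        then λ _ → charge-run arith
        then λ _ → forEach-sum I {f = f} (λ j y y∈ → r j y (there y∈)) (suc i))
    where
    count : ∀ a b → 1 + (a + (1 + suc b)) ≡ suc (2 + a + b)
    count = solve-∀

  -- The exit test is charged to m ≥ 1, which makes 3 operations per iteration beside the body;
  -- these fit into 3 units because U ≥ 1.
  forEach-price : ∀ {l m} k → .{{NonZero m}} → .{{NonZero U}} → l ≤ m →
                  suc (l * (2 + k * U)) * 1 ≤ (3 + k) * (m * U)
  forEach-price {U} {l} {m} k l≤m = begin
    suc (l * (2 + k * U)) * 1     ≡⟨ *-identityʳ _ ⟩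
    1 + l * (2 + k * U)           ≤⟨ +-mono-≤ (>-nonZero⁻¹ m) (*-monoˡ-≤ _ l≤m) ⟩
    m + m * (2 + k * U)           ≡⟨ *-suc m (2 + k * U) ⟨
    m * (3 + k * U)               ≤⟨ *-monoʳ-≤ m (+-monoˡ-≤ (k * U) (*-monoʳ-≤ 3 (>-nonZero⁻¹ U))) ⟩
    m * (3 * U + k * U)           ≡⟨ swap m k U ⟩
    (3 + k) * (m * U)             ∎
    where
    open ≤-Reasoning
    swap : ∀ m k u → m * (3 * u + k * u) ≡ (3 + k) * (m * u)
    swap = solve-∀

  forEach-run : ∀ (xs : List X) {f m} → .{{NonZero m}} → .{{NonZero U}} → length xs ≤ m →
                (∀ x → x ∈ xs → Run N (f x) N k U) →
                Run N (forEach xs f) N (3 + k) (m * U)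
  forEach-run {N = N} {k} xs {f} ≤m r =
    weaken ≤-refl (forEach-price k ≤m) (forEach-sum (λ _ → N) {xs} {f} (λ _ → r) 0)

  forEach-grow : ∀ (xs : List X) {f m} g → .{{NonZero m}} → .{{NonZero U}} → length xs ≤ m →
                 (∀ {N} x → Run N (f x) (g + N) k U) →
                 Run N (forEach xs f) (m * g + N) (3 + k) (m * U)
  forEach-grow {U = U} {k = k} {N} xs {f} g ≤m r =
    weaken (+-monoˡ-≤ N (*-monoˡ-≤ g (≤-trans (≤-reflexive (+-identityʳ (length xs))) ≤m)))
      (forEach-price k ≤m)
      (forEach-sum {k = k} {U} (λ i → i * g + N) {xs} {f}
        (λ i x _ → weaken (≤-reflexive (sym (+-assoc g (i * g) N))) ≤-refl (r x)) 0)

  #-returns : (x : X) → Returns (# x) x 0 U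
  #-returns x = returns (λ _ → refl) (λ _ → refl) (λ _ → z≤n)

  op₁-returns : ∀ o (f : X → Y) {p v} {_ : Basic o} → .{{NonZero U}} →
                Returns p v k U → Returns (op₁ o f p) (f v) (k + 1) U
  op₁-returns {k = k} o f {_} {_} {b} (returns v m t) = returns
    (λ σ → cong f (v σ)) m (λ σ → +-price k 1 (t σ) (+-price 1 0 (basic-price o {b}) z≤n))

  op₂-returns : ∀ o (f : X → Y → Z) {p q v w} {_ : Basic o} → .{{NonZero U}} →
                Returns p v k U → Returns q w k′ U →
                Returns (op₂ o f p q) (f v w) (k + (k′ + 1)) U
  op₂-returns {k = k} {k′} o f {_} {_} {_} {_} {b} (returns v m t) (returns v′ m′ t′) = returns
    (λ σ → cong₂ f (v σ) (v′ _))
    (λ σ → trans (m′ _) (m σ))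
    (λ σ → +-price k (k′ + 1) (t σ) (+-price k′ 1 (t′ _) (+-price 1 0 (basic-price o {b}) z≤n)))

  -- The continuation gets a variable with an equation, not `v` itself: a loop limit stays a
  -- variable in the program, and the equation serves only to bound the length of the range.
  _binding_ : ∀ {p : Comp X} {f : X → Comp Y} {v} →
              Returns p v k U → (∀ x → x ≡ v → Run N (f x) M k′ U) → Run N (p >>= f) M (k + k′) U
  _binding_ {k = k} {k′ = k′} {p} (returns v m t) r .step σ h
    with step (r (proj₁ (p σ)) (v σ)) (proj₁ (proj₂ (p σ))) (subst (Short _) (sym (m σ)) h)
  ... | h′ , t′ = h′ , +-price k k′ (t σ) t′

  returns⇒run : ∀ {p : Comp X} {v} → Returns p v k U → Run N p N k U
  returns⇒run (returns v m t) .step σ h = subst (Short _) (sym (m σ)) h , t σ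

  -- The invariant of the memory becomes a fact about the list that was read. Both the price of a
  -- binary search and the length of a list after an append rest on it.
  mistakes-then : ∀ i j x {f : List ℤ → Comp X} → .{{NonZero U}} →
                  (∀ a → length a ≤ N → Run N (f a) M k U) →
                  Run N (MISTAKES i j (# x) >>= f) M (1 + k) U
  mistakes-then {k = k} i j x r .step σ h with step (r _ (h _)) σ h
  ... | h′ , t = h′ , +-price 1 k (basic-price access) t

  -- Proofs of Run are built from the leaves up, which determines the program q; it agrees
  -- with the program p of the paper only after unfolding the operators.
  cast : ∀ {p q : Comp X} {_ : T (k ≤ᵇ k′)} → Run N q M k U → p ≡ q → Run N p M k′ U
  cast {_} {k} {k′} {_} {_} {_} {_} {_} {k≤} r refl = more (≤ᵇ⇒≤ k k′ k≤) r

-- Keeping d, B and E (namely 4 * c, searchCost (appends n d) and 2 ^ n) abstract prevents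
-- them from being unfolded when units are compared.
module Algorithm (cost : Op → ℕ) (κ : ℕ) (cost≤ : ∀ o → cost o ≤ κ * nominal o)
                 {A : Set} (_≟_ : DecidableEquality A) {n : ℕ} (s : Fin n → List A) (K : ℕ)
                 (c d : ℕ) .{{n≢0 : NonZero n}} .{{d≢0 : NonZero d}}
                 (B : ℕ) .{{B≢0 : NonZero B}} (searchCost≤B : searchCost (appends n d) ≤ B)
                 (E : ℕ) .{{E≢0 : NonZero E}} (2^n≤E : 2 ^ n ≤ E)
                 (3c<d : 3 * c < d) (length≤c : ∀ i → length (s i) ≤ c) where

  open SCSK cost _≟_ s K
  open Memory
  open CostLogic cost κ cost≤ _≟_ s K
  open Run

  private variable
    X : Set
    N M k k′ U : ℕ

  maxMistakes : ℕ
  maxMistakes = appends n d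

  -- Prices of the operators and memory accesses.

  infixl 7 _⊠ʳ_
  infixl 6 _⊞ʳ_ _⊟ʳ_ _⊞∞ʳ_ _⊟∞ʳ_ _⊕ʳ_ _⊞ᵛ_ _⊟ᵛ_
  infixl 5 _&ʳ_
  infix  4 _<ʳ_ _≤ʳ_ _≥ʳ_ _≡ʳ_ _≢ʳ_ _≢ℕʳ_ _≢ᴬʳ_
  infixr 3 _andʳ_
  infixr 2 _orʳ_

  _⊞ʳ_ : ∀ {p q} → .{{NonZero U}} →
    Run N p N k U → Run N q N k′ U → Run N (p ⊞ q) N (k + (k′ + 1)) U
  _⊞ʳ_ = op₂-run arith ℤ._+_

  _⊟ʳ_ : ∀ {p q} → .{{NonZero U}} →
    Run N p N k U → Run N q N k′ U → Run N (p ⊟ q) N (k + (k′ + 1)) U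
  _⊟ʳ_ = op₂-run arith ℤ._-_

  _⊠ʳ_ : ∀ {p q} → .{{NonZero U}} →
    Run N p N k U → Run N q N k′ U → Run N (p ⊠ q) N (k + (k′ + 1)) U
  _⊠ʳ_ = op₂-run arith ℤ._*_

  _⊞∞ʳ_ : ∀ {p q} → .{{NonZero U}} →
    Run N p N k U → Run N q N k′ U → Run N (p ⊞∞ q) N (k + (k′ + 1)) U
  _⊞∞ʳ_ = op₂-run arith _+∞_

  _⊟∞ʳ_ : ∀ {p q} → .{{NonZero U}} →
    Run N p N k U → Run N q N k′ U → Run N (p ⊟∞ q) N (k + (k′ + 1)) U
  _⊟∞ʳ_ = op₂-run arith _-∞_

  _<ʳ_ : ∀ {p q} → .{{NonZero U}} →
    Run N p N k U → Run N q N k′ U → Run N (p <ᶜ q) N (k + (k′ + 1)) U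
  _<ʳ_ = op₂-run compare (λ x y → does (x ℤ.<? y))

  _≤ʳ_ : ∀ {p q} → .{{NonZero U}} →
    Run N p N k U → Run N q N k′ U → Run N (p ≤ᶜ q) N (k + (k′ + 1)) U
  _≤ʳ_ = op₂-run compare (λ x y → does (x ℤ.≤? y))

  _≥ʳ_ : ∀ {p q} → .{{NonZero U}} →
    Run N p N k U → Run N q N k′ U → Run N (p ≥ᶜ q) N (k + (k′ + 1)) U
  _≥ʳ_ = op₂-run compare (λ x y → does (y ℤ.≤? x))

  _≡ʳ_ : ∀ {p q} → .{{NonZero U}} →
    Run N p N k U → Run N q N k′ U → Run N (p ≡ᶜ q) N (k + (k′ + 1)) U
  _≡ʳ_ = op₂-run compare (λ x y → does (x ℤ.≟ y))

  _≢ʳ_ : ∀ {p q} → .{{NonZero U}} →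
    Run N p N k U → Run N q N k′ U → Run N (p ≢ᶜ q) N (k + (k′ + 1)) U
  _≢ʳ_ = op₂-run compare (λ x y → not (does (x ℤ.≟ y)))

  _≢ℕʳ_ : ∀ {p q} → .{{NonZero U}} →
    Run N p N k U → Run N q N k′ U → Run N (p ≢ℕ q) N (k + (k′ + 1)) U
  _≢ℕʳ_ = op₂-run compare (λ x y → not (does (x ℕ.≟ y)))

  _⊕ʳ_ : ∀ {p q} → .{{NonZero U}} →
    Run N p N k U → Run N q N k′ U → Run N (p ⊕ q) N (k + (k′ + 1)) U
  _⊕ʳ_ = op₂-run bitwise _xorᵇ_

  _&ʳ_ : ∀ {p q} → .{{NonZero U}} →
    Run N p N k U → Run N q N k′ U → Run N (p & q) N (k + (k′ + 1)) U
  _&ʳ_ = op₂-run bitwise _andᵇ_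

  _≢ᴬʳ_ : ∀ {p q} → .{{NonZero U}} →
    Run N p N k U → Run N q N k′ U → Run N (p ≢ᴬ q) N (k + (k′ + 1)) U
  _≢ᴬʳ_ = op₂-run compare (λ x y → not (does (Maybe.≡-dec _≟_ x y)))

  MIN-run : ∀ {p q} → .{{NonZero U}} →
    Run N p N k U → Run N q N k′ U → Run N (MIN p q) N (k + (k′ + 1)) U
  MIN-run = op₂-run minMax _⊓∞_

  _⊞ᵛ_ : ∀ {p q v w} → .{{NonZero U}} →
    Returns p v k U → Returns q w k′ U → Returns (p ⊞ q) (v ℤ.+ w) (k + (k′ + 1)) U
  _⊞ᵛ_ = op₂-returns arith ℤ._+_

  _⊟ᵛ_ : ∀ {p q v w} → .{{NonZero U}} →
    Returns p v k U → Returns q w k′ U → Returns (p ⊟ q) (v ℤ.- w) (k + (k′ + 1)) U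
  _⊟ᵛ_ = op₂-returns arith ℤ._-_

  MAX-returns : ∀ {p q v w} → .{{NonZero U}} →
    Returns p v k U → Returns q w k′ U → Returns (MAX p q) (v ℤ.⊔ w) (k + (k′ + 1)) U
  MAX-returns = op₂-returns minMax ℤ._⊔_

  ANS-run : .{{NonZero U}} → Run N ANS N 1 U
  ANS-run = read-run ans

  _orʳ_ : ∀ {p q} → Run N p N k U → Run N q N k′ U → Run N (p or q) N (k + (0 + k′)) U
  r orʳ r′ = ifᶜ-run r (#-run true) r′

  _andʳ_ : ∀ {p q} → Run N p N k U → Run N q N k′ U → Run N (p and q) N (k + (k′ + 0)) U
  r andʳ r′ = ifᶜ-run r r′ (#-run false)

  len-returns : ∀ i → .{{NonZero U}} → Returns (len i) (+ length (s i)) 1 U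
  len-returns i = op₁-returns readLength (λ a → + length a) (#-returns (s i))

  len-run : ∀ i → .{{NonZero U}} → Run N (len i) N 1 U
  len-run i = op₁-run readLength (λ a → + length a) (#-run (s i))

  char-run : ∀ i x → .{{NonZero U}} → Run N (char i x) N 1 U
  char-run i x = op₁-run readChar (charAt (s i)) (#-run x)

  ≢ˢ-run : ∀ i j → .{{NonZero U}} → Run N (i ≢ˢ j) N 1 U
  ≢ˢ-run i j = op₂-run compare (λ x y → not (does (x Fin.≟ y))) (#-run i) (#-run j)

  strings-run : ∀ {f} → .{{NonZero U}} → (∀ i → Run N (f i) N k U) →
                Run N (forEach strings f) N (3 + k) (n * U)
  strings-run {f = f} r =
    forEach-run strings {f} (≤-reflexive (length-tabulate {n = n} id)) (λ i _ → r i)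

  strings-grow : ∀ {f} g → .{{NonZero U}} → (∀ {N} i → Run N (f i) (g + N) k U) →
                 Run N (forEach strings f) (n * g + N) (3 + k) (n * U)
  strings-grow {f = f} g r =
    forEach-grow strings {f} g (≤-reflexive (length-tabulate {n = n} id)) r

  length-if≤ : ∀ {a x : List ℤ} b → length a ≤ M → length x ≤ M → length (if b then a else x) ≤ M
  length-if≤ true  a≤ _  = a≤
  length-if≤ false _  x≤ = x≤

  setMISTAKES-run : ∀ i j k a → .{{NonZero U}} → length a ≤ M → N ≤ M →
                    Run N (setMISTAKES i j k a) M 1 U
  setMISTAKES-run i j k a a≤ N≤M = write-run _ λ σ h key →
    length-if≤ (does (key ≟ₖ (i , j , k))) a≤ (≤-trans (h key) N≤M)
    where _≟ₖ_ = Product.≡-dec Fin._≟_ (Product.≡-dec Fin._≟_ ℤ._≟_)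

  appendMISTAKES-run : ∀ i j k x → .{{NonZero U}} → Run N (appendMISTAKES i j k x) (1 + N) 3 U
  appendMISTAKES-run {N = N} i j k x = mistakes-then i j k λ a a≤ →
    charge-run append thenₛ setMISTAKES-run i j k (a ∷ʳ x)
      (≤-trans (≤-reflexive (trans (length-++ a) (+-comm (length a) 1))) (s≤s a≤)) (n≤1+n N)

  -- An interval from 0 to `3 * c` has one position more than `3 * c`, hence the strict inequality
  -- required of `d`.
  positions≤d : ∀ {a b} m {_ : T (m ≤ᵇ 3)} → 0ℤ ℤ.≤ a → b ℤ.≤ + (m * c) → length [ a ⋯ b ] ≤ d
  positions≤d m {m≤3} 0≤a b≤ =
    ≤-trans (length-interval≤ 0≤a b≤) (≤-trans (s≤s (*-monoˡ-≤ c (≤ᵇ⇒≤ m 3 m≤3))) 3c<d)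

  overlaps≤d : ∀ {x} i j → x ≡ + length (s i) ℤ.+ + length (s j) ℤ.- 1ℤ → length [ 0ℤ ⋯ x ] ≤ d
  overlaps≤d i j refl = positions≤d 2 ℤ.≤-refl
    (ℤ.≤-trans (ℤ.i-j≤i _ 1ℤ)
      (+≤+ (+-mono-≤ (length≤c i) (≤-trans (length≤c j) (m≤m+n c 0)))))

  mistakes-run : ∀ i j {p} → .{{NonZero U}} → Run N p N k U → Run N (MISTAKES i j p) N (k + 1) U
  mistakes-run i j r = r then λ x → read-run (λ σ → mistakes σ (i , j , x))

  size-run : ∀ {p} → .{{NonZero U}} → Run N p N k U → Run N (size p) N (k + 1) U
  size-run = op₁-run readLength (λ a → + length a)

  pairwiseDistinct-run : ∀ l m r → .{{NonZero U}} → Run N (pairwiseDistinct l m r) N 3 U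
  pairwiseDistinct-run l m r = ≢ˢ-run l m andʳ ≢ˢ-run m r andʳ ≢ˢ-run l r

  full-returns : .{{NonZero U}} → Returns full (2 ^ n ∸ 1) 2 U
  full-returns = op₂-returns arith _∸_ (op₁-returns power (λ y → 2 ^ y) (#-returns n)) (#-returns 1)

  2^-run : ∀ x → .{{NonZero U}} → Run N (2^ x) N 1 U
  2^-run x = op₁-run power (λ y → 2 ^ y) (#-run x)

  bitSet-run : ∀ i mask → .{{NonZero U}} → Run N (bitSet i mask) N 3 U
  bitSet-run i mask = (2^-run (toℕ i) &ʳ #-run mask) ≢ℕʳ #-run 0

  masks≤ : ∀ a {top} → top ≡ 2 ^ n ∸ 1 → length [ a ⋯ top ]ℕ ≤ E
  masks≤ a refl = ≤-trans (length-[⋯2^n∸1]≤ a n) 2^n≤E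

  -- Prices of the procedures.

  -- The factors follow the nesting of the loops, outermost first. Factors left over are taken as
  -- the unit of the innermost body, which need only be positive: thus `pairUnit` contains `B`
  -- although no search occurs there, and the DP tables, with two loops over strings inside the loop
  -- over masks, are allowed a third factor `n`.
  pairUnit tripleUnit subsetUnit : ℕ
  pairUnit   = n * (n * (d * (d * B)))
  tripleUnit = n * (n * (n * (d * (d * B))))
  subsetUnit = E * (n * (n * n))

  rotate : ∀ n e → n * (n * (n * e)) ≡ e * (n * (n * n))
  rotate = solve-∀

  offsets≤d : ∀ {x} j → x ≡ + length (s j) ℤ.- 1ℤ → length [ 0ℤ ⋯ x ] ≤ d
  offsets≤d j refl = positions≤d 1 ℤ.≤-refl
    (ℤ.≤-trans (ℤ.i-j≤i _ 1ℤ) (+≤+ (≤-trans (length≤c j) (m≤m+n c 0))))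

  initMISTAKES-run : Run 0 initMISTAKES 0 20 pairUnit
  initMISTAKES-run = cast
    (strings-run λ i → strings-run λ j → when-run ≤-refl (≢ˢ-run j i)
      ((len-returns i ⊞ᵛ len-returns j) ⊟ᵛ #-returns 1ℤ
        binding λ hi hi≡ → forEach-run [ 0ℤ ⋯ hi ] (overlaps≤d i j hi≡) λ k _ →
      setMISTAKES-run i j k [] z≤n ≤-refl))
    refl

  MISTAKES_FOR_PAIRS-run : Run 0 MISTAKES_FOR_PAIRS maxMistakes 100 pairUnit
  MISTAKES_FOR_PAIRS-run = weaken {k = 100} {pairUnit} (≤-reflexive (+-identityʳ maxMistakes)) ≤-refl (cast
    (initMISTAKES-run thenₛ
     strings-grow (n * (d * (d * 1))) λ i → strings-grow (d * (d * 1)) λ {N} j →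
     when-run (m≤n+m N _) (≢ˢ-run j i)
      ((len-returns i ⊞ᵛ len-returns j) ⊟ᵛ #-returns 1ℤ
        binding λ kmax kmax≡ → forEach-grow [ 0ℤ ⋯ kmax ] (d * 1) (overlaps≤d i j kmax≡) λ k →
       len-returns j ⊟ᵛ #-returns 1ℤ
        binding λ tmax tmax≡ → forEach-grow [ 0ℤ ⋯ tmax ] 1 (offsets≤d j tmax≡) λ {N} t →
       ((#-run k ⊟ʳ len-run j) ⊞ʳ #-run 1ℤ) ⊞ʳ #-run t then λ x →
       when-run (n≤1+n N)
         ((#-run 0ℤ ≤ʳ #-run x) andʳ (#-run x <ʳ len-run i) andʳ
          (char-run j t ≢ᴬʳ char-run i x))
         (appendMISTAKES-run i j k x)))
    refl)

  ≡ˢ-run : ∀ i j → .{{NonZero U}} → Run N (i ≡ˢ j) N 1 U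
  ≡ˢ-run i j = op₂-run compare (λ x y → does (x Fin.≟ y)) (#-run i) (#-run j)

  setLMR-run : ∀ l m r x → .{{NonZero U}} → Run N (setLMR l m r x) N 1 U
  setLMR-run l m r x = write-run _ λ _ h → h

  setOVERLAP-run : ∀ w v x → .{{NonZero U}} → Run N (setOVERLAP w v x) N 1 U
  setOVERLAP-run w v x = write-run _ λ _ h → h

  setDP_RIGHT-run : ∀ mask i x → .{{NonZero U}} → Run N (setDP_RIGHT mask i x) N 1 U
  setDP_RIGHT-run mask i x = write-run _ λ _ h → h

  setDP_LEFT-run : ∀ mask i x → .{{NonZero U}} → Run N (setDP_LEFT mask i x) N 1 U
  setDP_LEFT-run mask i x = write-run _ λ _ h → h

  setANS-run : ∀ x → .{{NonZero U}} → Run N (setANS x) N 1 U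
  setANS-run x = write-run _ λ _ h → h

  LMR-run : ∀ l m r → .{{NonZero U}} → Run N (LMR l m r) N 1 U
  LMR-run l m r = read-run λ σ → lmr σ (l , m , r)

  OVERLAP-run : ∀ w v → .{{NonZero U}} → Run N (OVERLAP w v) N 1 U
  OVERLAP-run w v = read-run λ σ → overlaps σ (w , v)

  DP_RIGHT-run : ∀ i {p} → .{{NonZero U}} → Run N p N k U → Run N (DP_RIGHT p i) N (k + 1) U
  DP_RIGHT-run i r = r then λ mask → read-run λ σ → dpRight σ (mask , i)

  DP_LEFT-run : ∀ i {p} → .{{NonZero U}} → Run N p N k U → Run N (DP_LEFT p i) N (k + 1) U
  DP_LEFT-run i r = r then λ mask → read-run λ σ → dpLeft σ (mask , i)

  finite-run : ∀ {p} → Run N p N k U → Run N (finite p) N (k + 0) U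
  finite-run r = r then λ x → #-run [ x ]

  <ANS-run : ∀ x → .{{NonZero U}} → Run N (x <ANS) N 2 U
  <ANS-run x .step σ h = h , +-price 1 1 (basic-price access) (+-price 1 0 (basic-price compare) z≤n)

  -- `B` is chosen so that one search on a list of at most `maxMistakes` entries is one unit. The
  -- bound concerns the list already read, so it survives the evaluation of `q`.
  BINARYSEARCH-run : ∀ i j x {q} → Run maxMistakes q maxMistakes k B →
                     Run maxMistakes (BINARYSEARCH (MISTAKES i j (# x)) q) maxMistakes (1 + (k + (1 + 0))) B
  BINARYSEARCH-run i j x r = mistakes-then i j x λ a a≤ → r then λ y →
    run {p = charge (binarySearch (length a))} {k = 1} (λ _ h → h ,
      op-price (binarySearch (length a)) (≤-trans (searchCost-mono a≤) searchCost≤B))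
    thenₛ #-run (searchIndex a y)

  countMistakes-run : ∀ l m r L M R ℓ start → Run maxMistakes (countMistakes l m r L M R ℓ start) maxMistakes 50 B
  countMistakes-run l m r L M R ℓ start = cast
    (((#-run start ⊞ʳ #-run M) ⊟ʳ #-run 1ℤ) then λ E →
     (#-run E ⊟ʳ (#-run ℓ ⊟ʳ #-run R)) then λ E′ →
     ifᶜ-run (#-run E <ʳ #-run L)
       (size-run (mistakes-run l m (#-run E)))
       (ifᶜ-run (#-run start ≥ʳ (#-run ℓ ⊟ʳ #-run R))
         (size-run (mistakes-run r m (#-run E′)))
         (ifᶜ-run (#-run ℓ ≥ʳ (#-run L ⊞ʳ #-run R))
           (ifᶜ-run (#-run start <ʳ #-run L)
              (#-run 0ℤ ⊞ʳ size-run (mistakes-run l m (#-run E))) (#-run 0ℤ) then λ MS →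
            ifᶜ-run (#-run E′ ≥ʳ #-run 0ℤ)
              (#-run MS ⊞ʳ size-run (mistakes-run r m (#-run E′))) (#-run MS))
           ((size-run (mistakes-run l m (#-run E)) ⊞ʳ size-run (mistakes-run r m (#-run E′)))
             ⊟ʳ BINARYSEARCH-run r m E′
                  (((#-run L ⊞ʳ #-run R) ⊟ʳ #-run ℓ) ⊟ʳ #-run 1ℤ)))))
    refl

  maxLength≤ : ∀ {L M R hi} l m r → L ≡ + length (s l) → M ≡ + length (s m) → R ≡ + length (s r) →
               hi ≡ L ℤ.+ R ℤ.+ M → hi ℤ.≤ + (3 * c)
  maxLength≤ l m r refl refl refl refl = +≤+ (begin
    length (s l) + length (s r) + length (s m)   ≤⟨ +-mono-≤ (+-mono-≤ (length≤c l) (length≤c r)) (length≤c m) ⟩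
    c + c + c                                    ≡⟨ 3*c c ⟩
    3 * c                                        ∎)
    where
    open ≤-Reasoning
    3*c : ∀ c → c + c + c ≡ 3 * c
    3*c = solve-∀

  0≤max : ∀ {L R lo} l → L ≡ + length (s l) → lo ≡ L ℤ.⊔ R → 0ℤ ℤ.≤ lo
  0≤max {R = R} l refl refl = ℤ.≤-trans (+≤+ z≤n) (ℤ.i≤i⊔j _ R)

  starts≤d : ∀ {ℓ hi M smax} m → M ≡ + length (s m) → smax ≡ ℓ ℤ.- M →
             ℓ ℤ.≤ hi → hi ℤ.≤ + (3 * c) → length [ 0ℤ ⋯ smax ] ≤ d
  starts≤d m refl refl ℓ≤ hi≤ =
    positions≤d 3 ℤ.≤-refl (ℤ.≤-trans (ℤ.i-j≤i _ (+ length (s m))) (ℤ.≤-trans ℓ≤ hi≤))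

  -- The body of SCSK_FOR_TRIPLES is cut into named pieces because comparing the whole of it
  -- with the program of a proof is infeasible: _>>=_ duplicates the state when unfolded.
  tryPlacements : (l m r : Idx) (L M R ℓ : ℤ) → Comp ⊤
  tryPlacements l m r L M R ℓ = do
    smax ← # ℓ ⊟ # M
    forEach [ 0ℤ ⋯ smax ] λ start → do
      MS ← countMistakes l m r L M R ℓ start
      when (# MS ≤ᶜ # (+ K)) do
        best ← MIN (# [ ℓ ]) (LMR l m r)
        setLMR l m r best

  tryPlacements-run : ∀ l m r L M R ℓ → (∀ {x} → x ≡ ℓ ℤ.- M → length [ 0ℤ ⋯ x ] ≤ d) →
                      Run maxMistakes (tryPlacements l m r L M R ℓ) maxMistakes 80 (d * B)
  tryPlacements-run l m r L M R ℓ smax≤d = cast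
    (#-returns ℓ ⊟ᵛ #-returns M binding λ smax smax≡ →
     forEach-run [ 0ℤ ⋯ smax ] (smax≤d smax≡) λ start _ →
     countMistakes-run l m r L M R ℓ start then λ MS →
     when-run ≤-refl (#-run MS ≤ʳ #-run (+ K))
       (MIN-run (#-run [ ℓ ]) (LMR-run l m r) then λ best →
        setLMR-run l m r best))
    refl

  LROverlaps : (l r : Idx) (L R ℓ : ℤ) → Comp Bool
  LROverlaps l r L R ℓ =
    # ℓ <ᶜ # L ⊞ # R and
    size (MISTAKES l r (# (+ 2) ⊠ # L ⊞ # R ⊟ # ℓ ⊟ # 1ℤ)) ≢ᶜ # 0ℤ

  LROverlaps-run : ∀ l r L R ℓ → .{{NonZero U}} → Run N (LROverlaps l r L R ℓ) N 20 U
  LROverlaps-run l r L R ℓ = cast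
    ((#-run ℓ <ʳ (#-run L ⊞ʳ #-run R)) andʳ
     (size-run (mistakes-run l r
        ((((#-run (+ 2) ⊠ʳ #-run L) ⊞ʳ #-run R) ⊟ʳ #-run ℓ) ⊟ʳ #-run 1ℤ)) ≢ʳ #-run 0ℤ))
    refl

  fillLMR : (l m r : Idx) → Comp ⊤
  fillLMR l m r = do
    L ← len l
    M ← len m
    R ← len r
    lo ← MAX (# L) (# R)
    hi ← # L ⊞ # R ⊞ # M
    forEach [ lo ⋯ hi ] λ ℓ → unless (LROverlaps l r L R ℓ) (tryPlacements l m r L M R ℓ)

  fillLMR-run : ∀ l m r → Run maxMistakes (fillLMR l m r) maxMistakes 120 (d * (d * B))
  fillLMR-run l m r = cast
    (len-returns l binding λ L L≡ →
     len-returns m binding λ M M≡ →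
     len-returns r binding λ R R≡ →
     MAX-returns (#-returns L) (#-returns R) binding λ lo lo≡ →
     (#-returns L ⊞ᵛ #-returns R) ⊞ᵛ #-returns M binding λ hi hi≡ →
     forEach-run [ lo ⋯ hi ] (positions≤d 3 (0≤max l L≡ lo≡) (maxLength≤ l m r L≡ M≡ R≡ hi≡)) λ ℓ ℓ∈ →
     unless-run (LROverlaps-run l r L R ℓ)
       (tryPlacements-run l m r L M R ℓ λ smax≡ →
          starts≤d m M≡ smax≡ (∈-interval⇒≤ ℓ∈) (maxLength≤ l m r L≡ M≡ R≡ hi≡)))
    refl

  SCSK_FOR_TRIPLES-run : Run maxMistakes SCSK_FOR_TRIPLES maxMistakes 200 tripleUnit
  SCSK_FOR_TRIPLES-run = cast
    ((strings-run λ l → strings-run λ m → strings-run λ r → setLMR-run l m r ⊤⁺) thenₛ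
     strings-run λ l → strings-run λ r → strings-run λ m →
     when-run ≤-refl (pairwiseDistinct-run l m r) (fillLMR-run l m r))
    refl

  COUNT_OVERLAPS-run : Run maxMistakes COUNT_OVERLAPS maxMistakes 50 pairUnit
  COUNT_OVERLAPS-run = cast
    ((strings-run λ w → strings-run λ v → setOVERLAP-run w v 0ℤ) thenₛ
     strings-run λ w → strings-run λ v → ifᶜ-run (≡ˢ-run v w)
       (len-run v then λ x → setOVERLAP-run w v x)
       (len-returns w binding λ omax omax≡ →
        forEach-run [ 1ℤ ⋯ omax ] (positions≤d 1 (+≤+ z≤n) (lengths≤ w omax≡)) λ o _ →
        when-run ≤-refl (size-run (mistakes-run v w (#-run o)) ≡ʳ #-run 0ℤ) (setOVERLAP-run w v o)))
    refl
    where
    lengths≤ : ∀ {x} i → x ≡ + length (s i) → x ℤ.≤ + (1 * c)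
    lengths≤ i refl = +≤+ (≤-trans (length≤c i) (m≤m+n c 0))

  initDP-run : (set : ℕ → Idx → ℤ∞ → Comp ⊤) →
               (∀ {U} mask j x → .{{NonZero U}} → Run N (set mask j x) N 1 U) →
               Run N (initDP set) N 30 subsetUnit
  initDP-run set set-run = cast
    (full-returns binding λ top top≡ →
     (forEach-run [ 0 ⋯ top ]ℕ (masks≤ 0 top≡) λ mask _ → strings-run λ j → set-run mask j ⊤⁺) thenₛ
     -- This loop runs over strings only, so its unit must begin with `n`, whereas `subsetUnit`
     -- begins with `E`.
     weaken {k = 6} {U = n * (n * (n * E))} {k′ = 6} {V = subsetUnit} ≤-refl
       (*-monoʳ-≤ 6 (≤-reflexive (rotate n E)))
      (strings-run λ j →
      2^-run (toℕ j) then λ mask → len-run j then λ x → set-run mask j [ x ]))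
    refl

  FILL_DP_RIGHT-run : Run N FILL_DP_RIGHT N 80 subsetUnit
  FILL_DP_RIGHT-run = cast
    (initDP-run setDP_RIGHT setDP_RIGHT-run thenₛ
     full-returns binding λ top top≡ →
     forEach-run [ 1 ⋯ top ]ℕ (masks≤ 1 top≡) λ mask _ → strings-run λ right →
     when-run ≤-refl (bitSet-run right mask) (strings-run λ p →
     when-run ≤-refl (bitSet-run p mask andʳ ≢ˢ-run p right)
      (MIN-run (DP_RIGHT-run right (#-run mask))
         (((DP_RIGHT-run p (#-run mask ⊕ʳ 2^-run (toℕ right)))
            ⊞∞ʳ finite-run (len-run right)) ⊟∞ʳ OVERLAP-run p right) then λ x →
       setDP_RIGHT-run mask right x)))
    refl

  FILL_DP_LEFT-run : Run N FILL_DP_LEFT N 80 subsetUnit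
  FILL_DP_LEFT-run = cast
    (initDP-run setDP_LEFT setDP_LEFT-run thenₛ
     full-returns binding λ top top≡ →
     forEach-run [ 1 ⋯ top ]ℕ (masks≤ 1 top≡) λ mask _ → strings-run λ left →
     when-run ≤-refl (bitSet-run left mask) (strings-run λ p →
     when-run ≤-refl (bitSet-run p mask andʳ ≢ˢ-run p left)
      (MIN-run (DP_LEFT-run left (#-run mask))
         (((DP_LEFT-run p (#-run mask ⊕ʳ 2^-run (toℕ left)))
            ⊞∞ʳ finite-run (len-run left)) ⊟∞ʳ OVERLAP-run left p) then λ x →
       setDP_LEFT-run mask left x)))
    refl

  MAIN_LOOP-run : Run N MAIN_LOOP N 80 (n * (n * (n * (E * 1))))
  MAIN_LOOP-run = cast
    (setANS-run nothing thenₛ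
     (strings-run λ l → strings-run λ m → strings-run λ r →
      when-run ≤-refl (pairwiseDistinct-run l m r)
       (full-returns binding λ top top≡ →
        forEach-run [ 0 ⋯ top ]ℕ (masks≤ 0 top≡) λ leftMask _ →
        (returns⇒run full-returns ⊕ʳ #-run leftMask) then λ rightMask →
        when-run ≤-refl (bitSet-run l leftMask andʳ bitSet-run r rightMask)
         ((((LMR-run l m r ⊟∞ʳ len-run l) ⊟∞ʳ len-run r)
            ⊞∞ʳ DP_RIGHT-run l (#-run leftMask)) ⊞∞ʳ DP_LEFT-run r (#-run rightMask) then λ x →
          when-run ≤-refl (op₁-run compare isNull ANS-run orʳ <ANS-run x)
            (setANS-run (just x))))) thenₛ
     ANS-run)
    refl

  -- The total time.

  budget : ℕ
  budget = tripleUnit + n * (n * (n * E))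

  -- The procedures add up to 100 + 200 + (50 + 80 + 80) + 80 = 590 units, rounded up to 640; `cast`
  -- checks the inequality by evaluation.
  algorithm-run : Run 0 algorithm maxMistakes 640 budget
  algorithm-run = cast
    (within 100 pairUnit≤ MISTAKES_FOR_PAIRS-run thenₛ
     within 200 (m≤m+n tripleUnit _) SCSK_FOR_TRIPLES-run thenₛ
     (within 50 pairUnit≤ COUNT_OVERLAPS-run thenₛ
      within 80 subsetUnit≤ FILL_DP_RIGHT-run thenₛ
      within 80 subsetUnit≤ FILL_DP_LEFT-run) thenₛ
     within 80 mainUnit≤ MAIN_LOOP-run)
    refl
    where
    within : ∀ k {p : Comp X} → U ≤ budget → Run N p M k U → Run N p M k budget
    within k U≤ = weaken ≤-refl (*-monoʳ-≤ k U≤)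

    pairUnit≤ : pairUnit ≤ budget
    pairUnit≤ = ≤-trans (m≤n*m pairUnit n) (m≤m+n tripleUnit _)

    subsetUnit≤ : subsetUnit ≤ budget
    subsetUnit≤ = ≤-trans (≤-reflexive (sym (rotate n E))) (m≤n+m _ tripleUnit)

    mainUnit≤ : n * (n * (n * (E * 1))) ≤ budget
    mainUnit≤ = ≤-trans (≤-reflexive (cong (λ e → n * (n * (n * e))) (*-identityʳ E))) (m≤n+m _ tripleUnit)

theorem1 : (cost : Op → ℕ) → IsCostModel cost →
    Σ[ C ∈ ℕ ]
    ((A : Set) (_≟_ : DecidableEquality A) (n : ℕ) (s : Fin n → List A) (K : ℕ) →
    1 ≤ n → Nonempty s → SubstringFree s → 2 ≤ longest s →
    SCSK.time cost _≟_ s K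
    ≤ C * (n ^ 3 * longest s ^ 2 * ⌊log₂ longest s ⌋ + n ^ 3 * 2 ^ n))
-- `κ` comes from the cost model, 640 is the number of units spent, and 2081 compares a unit with
-- the claimed bound.
theorem1 cost (κ , cost≤) = κ * 640 * 2081 , λ A _≟_ n s K 1≤n _ _ 2≤c →
  let
    c : ℕ
    c = longest s

    F : ℕ
    F = n ^ 3 * c ^ 2 * ⌊log₂ c ⌋ + n ^ 3 * 2 ^ n

    instance
      n≢0 : NonZero n
      n≢0 = >-nonZero 1≤n

      d≢0 : NonZero (4 * c)
      d≢0 = >-nonZero (*-mono-≤ {1} {4} (s≤s z≤n) (<⇒≤ 2≤c))

      2^n≢0 : NonZero (2 ^ n)
      2^n≢0 = m^n≢0 2 n

    -- For the chosen `d`, `B` and `E`, the sum on the right is `budget` by definition.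
    bound : SCSK.time cost _≟_ s K ≤ κ * (640 * (tripleCost n (4 * c) + subsetCost n))
    bound = proj₂ (CostLogic.Run.step
      (Algorithm.algorithm-run cost κ cost≤ _≟_ s K c (4 * c)
        (searchCost (appends n (4 * c))) ≤-refl (2 ^ n) ≤-refl
        (m<n+m (3 * c) (<⇒≤ 2≤c)) (length≤longest s))
      -- All lists are empty in the initial memory.
      _ (λ _ → z≤n))
  in begin
    SCSK.time cost _≟_ s K                                ≤⟨ bound ⟩
    κ * (640 * (tripleCost n (4 * c) + subsetCost n))     ≤⟨ *-monoʳ-≤ κ (*-monoʳ-≤ 640 (tripleCost+subsetCost≤ 1≤n 2≤c)) ⟩
    κ * (640 * (2081 * F))                                ≡⟨ *-assoc κ 640 (2081 * F) ⟨
    κ * 640 * (2081 * F)                                  ≡⟨ *-assoc (κ * 640) 2081 F ⟨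
    κ * 640 * 2081 * F                                    ∎
  where open ≤-Reasoning
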